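{- Let $\mathbb{K}$ be a field of characteristic zero and consider the invariant ring over digraphs $\overrightarrow{\mathcal{I}}_3$ on $n=3$ vertices. The two invariants $\mathcal{O}(\mathbf g_1)$ and $\mathcal{O}(\mathbf g_2)$, where $x^{\mathbf g_1}=x_{1,2}^2\,x_{2,3}$ and $x^{\mathbf g_2}=x_{1,2}\,x_{2,3}^2$, do not belong to the $\mathbb{K}$-subalgebra of $\overrightarrow{\mathcal{I}}_3$ generated by the invariants $\mathcal{O}(\mathbf g)$ with $\mathbf g$ a simple digraph on $3$ vertices. In particular $\overrightarrow{\mathcal{I}}_3$ is not generated by the invariants $\mathcal{O}(\mathbf g)$ with $\mathbf g$ a simple digraph.
   Context: Let $\mathbb{K}[x_{i,j}]$ be the polynomial ring in $n^2$ variables indexed by the ordered pairs $(i,j)\in\{1,\dots,n\}^2$ (including $i=j$). The symmetric group $\mathfrak{S}_n$ acts on it by $\sigma\cdot x_{i,j}=x_{\sigma(i),\sigma(j)}$, and $\overrightarrow{\mathcal{I}}_n:=\mathbb{K}[x_{i,j}]^{\mathfrak{S}_n}$ is the invariant ring over digraphs (directed graphs, with loops allowed). A multidigraph $\mathbf g$ on $n$ vertices is a family $(g_{i,j})$ of non-negative integers; it is a simple digraph if all $g_{i,j}\in\{0,1\}$. Write $x^{\mathbf g}=\prod x_{i,j}^{g_{i,j}}$ and $\mathcal{O}(\mathbf g)=\sum_{\mathbf h}x^{\mathbf h}$, the sum being over all distinct multidigraphs $\mathbf h$ in the $\mathfrak{S}_n$-orbit of $\mathbf g$. -}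

module Defs where

open import Algebra.Apartness.Bundles using (HeytingField; HeytingCommutativeRing)
open import Algebra.Bundles using (CommutativeRing)
import Algebra.Definitions.RawMonoid as RawMonoidDefinitions
open import Data.Bool.Base using (if_then_else_; _∧_)
open import Data.Fin.Base using (Fin; zero; suc)
open import Data.Fin.Patterns using (0F; 1F; 2F)
open import Data.Fin.Permutation as Perm using (Permutation′; _⟨$⟩ʳ_; _⟨$⟩ˡ_)
open import Data.Fin.Properties using (all?)
import Data.Fin.Properties as Fin
open import Data.List.Base
  using (List; []; _∷_; [_]; _++_; map; foldr; allFin; cartesianProductWith; deduplicate)
open import Data.Nat.Base as ℕ using (ℕ; zero; suc)
import Data.Nat.Properties as ℕ
open import Data.Product.Base using (∃-syntax; _×_; _,_; map₂)
open import Data.Sum.Base using (_⊎_)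
open import Level using (_⊔_)
open import Relation.Binary.Core using (Rel)
open import Relation.Binary.Definitions using (Decidable)
open import Relation.Binary.PropositionalEquality.Core using (_≡_)
open import Relation.Nullary.Decidable.Core using (does)
open import Relation.Nullary.Negation.Core using (¬_)
open import Relation.Unary using (Pred; _∈_)

private
  variable
    n : ℕ

CharacteristicZero : ∀ {c ℓ₁ ℓ₂} → HeytingField c ℓ₁ ℓ₂ → Set ℓ₁
CharacteristicZero K = ∀ m → ¬ (suc m · 1# ≈ 0#)
  where
  open HeytingField K using (_≈_; 0#; 1#; heytingCommutativeRing)
  open HeytingCommutativeRing heytingCommutativeRing using (commutativeRing)
  open CommutativeRing commutativeRing using (+-rawMonoid)
  open RawMonoidDefinitions +-rawMonoid using () renaming (_×_ to _·_)

------------------------------------------------------------------------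
-- Multidigraphs

-- The multidigraph g also serves as the exponent of the monomial x^g.
Multidigraph : ℕ → Set
Multidigraph n = Fin n → Fin n → ℕ

infix 4 _≐_ _≐?_

_≐_ : Rel (Multidigraph n) _
g ≐ h = ∀ i j → g i j ≡ h i j

_≐?_ : Decidable (_≐_ {n})
g ≐? h = all? λ i → all? λ j → g i j ℕ.≟ h i j

IsSimple : Multidigraph n → Set
IsSimple g = ∀ i j → g i j ≡ 0 ⊎ g i j ≡ 1

empty : Multidigraph n
empty _ _ = 0

edge : Fin n → Fin n → Multidigraph n
edge i j k l = if does (i Fin.≟ k) ∧ does (j Fin.≟ l) then 1 else 0

infixl 6 _⊕_

_⊕_ : Multidigraph n → Multidigraph n → Multidigraph n
(g ⊕ h) i j = g i j ℕ.+ h i j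

-- σ sends x i j to x (σ i) (σ j), so the exponent of x i j in σ · x^g
-- is that of x (σ⁻¹ i) (σ⁻¹ j) in x^g.
infixr 7 _▷_

_▷_ : Permutation′ n → Multidigraph n → Multidigraph n
(σ ▷ g) i j = g (σ ⟨$⟩ˡ i) (σ ⟨$⟩ˡ j)

-- A permutation of Fin (suc n) is determined by the image of zero and
-- by the permutation of Fin n it induces on the remaining points.
permutations : ∀ n → List (Permutation′ n)
permutations zero    = [ Perm.id ]
permutations (suc n) =
  cartesianProductWith (Perm.insert zero) (allFin (suc n)) (permutations n)

-- The distinct members of the orbit of g, each listed once.
orbit : Multidigraph n → List (Multidigraph n)
orbit {n} g = deduplicate _≐?_ (map (_▷ g) (permutations n))

-- x^g₁ = x₁₂² x₂₃ and x^g₂ = x₁₂ x₂₃², the vertices 1, 2, 3 being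
-- 0F, 1F, 2F.
g₁ g₂ : Multidigraph 3
g₁ = edge 0F 1F ⊕ edge 0F 1F ⊕ edge 1F 2F
g₂ = edge 0F 1F ⊕ edge 1F 2F ⊕ edge 1F 2F

------------------------------------------------------------------------
-- Polynomials

module Polynomials {c ℓ₁ ℓ₂} (K : HeytingField c ℓ₁ ℓ₂) where

  open HeytingField K

  -- K[x i j] is the free K-module on the monomials: a list of terms
  -- (a , g) stands for the sum of the a x^g, where several terms may
  -- share an exponent, and two lists are identified by _≈ₚ_ when all
  -- their coefficients agree.
  Polynomial : ℕ → Set c
  Polynomial n = List (Carrier × Multidigraph n)

  coefficient : Polynomial n → Multidigraph n → Carrier
  coefficient []            m = 0#
  coefficient ((a , g) ∷ p) m =
    if does (g ≐? m) then a + coefficient p m else coefficient p m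

  infix  4 _≈ₚ_
  infixl 6 _+ₚ_
  infixl 7 _*ₚ_
  infixr 7 _·ₚ_

  _≈ₚ_ : Rel (Polynomial n) ℓ₁
  p ≈ₚ q = ∀ m → coefficient p m ≈ coefficient q m

  constant : Carrier → Polynomial n
  constant a = [ a , empty ]

  _+ₚ_ : Polynomial n → Polynomial n → Polynomial n
  _+ₚ_ = _++_

  _*ₚ_ : Polynomial n → Polynomial n → Polynomial n
  _*ₚ_ = cartesianProductWith λ (a , g) (b , h) → a * b , g ⊕ h

  x^_ : Multidigraph n → Polynomial n
  x^ g = [ 1# , g ]

  sum : List (Polynomial n) → Polynomial n
  sum = foldr _+ₚ_ []

  _·ₚ_ : Permutation′ n → Polynomial n → Polynomial n
  σ ·ₚ p = map (map₂ (σ ▷_)) p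

  𝓘 : ∀ n → Pred (Polynomial n) ℓ₁
  𝓘 n p = ∀ (σ : Permutation′ n) → σ ·ₚ p ≈ₚ p

  𝓞 : Multidigraph n → Polynomial n
  𝓞 g = sum (map x^_ (orbit g))

  -- The K-subalgebra generated by S.  Negatives come from multiplication
  -- by constants.
  data ⟨_⟩ {s} (S : Pred (Polynomial n) s) : Pred (Polynomial n) (c ⊔ ℓ₁ ⊔ s) where
    generator : ∀ {p} → p ∈ S → p ∈ ⟨ S ⟩
    scalar    : ∀ a → constant a ∈ ⟨ S ⟩
    _⟨+⟩_     : ∀ {p q} → p ∈ ⟨ S ⟩ → q ∈ ⟨ S ⟩ → p +ₚ q ∈ ⟨ S ⟩
    _⟨*⟩_     : ∀ {p q} → p ∈ ⟨ S ⟩ → q ∈ ⟨ S ⟩ → p *ₚ q ∈ ⟨ S ⟩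
    respects  : ∀ {p q} → p ≈ₚ q → p ∈ ⟨ S ⟩ → q ∈ ⟨ S ⟩

  SimpleOrbitSums : ∀ n → Pred (Polynomial n) ℓ₁
  SimpleOrbitSums n p = ∃[ g ] IsSimple {n} g × p ≈ₚ 𝓞 g

{-# OPTIONS --safe #-}

-- Set every variable other than x₁₂ and x₂₃ to zero.  The polynomials whose
-- image in K[x₁₂, x₂₃] is symmetric form a subalgebra.  It contains 𝓞 g for
-- simple g: only the exponents 0 and 1 occur in 𝓞 g, and a 3-cycle carries
-- the edge 1 → 2 to the edge 2 → 3.  But 𝓞 g₁ and 𝓞 g₂ restrict to the
-- single monomials x₁₂² x₂₃ and x₁₂ x₂₃².

module Submission where

open import Algebra.Apartness.Bundles using (HeytingField; HeytingCommutativeRing)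
open import Algebra.Bundles using (CommutativeRing)
import Algebra.Properties.CommutativeSemigroup as CommutativeSemigroupProperties
open import Data.Bool.Base using (Bool; true; false; if_then_else_)
open import Data.Fin.Base using (zero; suc; opposite; punchIn)
open import Data.Fin.Patterns using (0F; 1F; 2F)
open import Data.Fin.Permutation as Perm
  using (Permutation′; _⟨$⟩ʳ_; _⟨$⟩ˡ_; flip; transpose; insert; remove; inverseˡ; inverseʳ; _∘ₚ_)
open import Data.Fin.Properties using (all?; opposite-involutive)
import Data.Fin.Properties as Fin
open import Data.List.Base using (List; []; _∷_; [_]; _++_; map; allFin)
open import Data.List.Membership.Propositional.Properties using (∈-allFin)
open import Data.List.Properties using (map-++; map-∘; cartesianProductWith-zeroʳ)
open import Data.List.Relation.Unary.All as All using (All)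
open import Data.List.Relation.Unary.All.Properties using (All¬⇒¬Any)
open import Data.List.Relation.Unary.AllPairs using (AllPairs; _∷_)
open import Data.List.Relation.Unary.Any as Any using (Any; here; there; any?)
import Data.List.Relation.Unary.Any.Properties as Any
import Data.List.Relation.Unary.Unique.DecSetoid.Properties as Unique
open import Data.Nat.Base as ℕ using (ℕ; zero; suc; 2+; _≤_; _∸_)
import Data.Nat.Properties as ℕ
open import Data.Product.Base using (_×_; _,_; ∃-syntax; map₂)
open import Data.Sum.Base using (inj₁; inj₂)
open import Function.Base using (_∘_)
open import Function.Bundles using (_⇔_; mk⇔; Equivalence)
open import Level using (0ℓ)
open import Relation.Binary.Bundles using (DecSetoid)
open import Relation.Binary.PropositionalEquality.Core as ≡ using (_≡_; refl; cong; cong₂)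
import Relation.Binary.Reasoning.Setoid as SetoidReasoning
open import Relation.Nullary.Decidable using (Dec; yes; no; does; does-⇔; from-yes; dec-true; dec-false)
open import Relation.Nullary.Negation.Core using (¬_)
open import Relation.Unary using (_∈_; _∉_; _⊆_)
open import Defs

private
  variable
    n : ℕ

-- Permutations

-- `Perm._≈_` compares forward maps only, whereas `_▷_` is built from inverse images.
⟨$⟩ˡ-cong : ∀ (π ρ : Permutation′ n) → π Perm.≈ ρ → ∀ i → π ⟨$⟩ˡ i ≡ ρ ⟨$⟩ˡ i
⟨$⟩ˡ-cong π ρ π≈ρ i = ≡.trans (≡.sym (inverseˡ ρ))
  (cong (ρ ⟨$⟩ˡ_) (≡.trans (≡.sym (π≈ρ (π ⟨$⟩ˡ i))) (inverseʳ π)))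

insert-cong : ∀ i j (π ρ : Permutation′ n) → π Perm.≈ ρ → insert i j π Perm.≈ insert i j ρ
insert-cong i j π ρ π≈ρ k with i Fin.≟ k
... | yes _ = refl
... | no  _ = cong (punchIn j) (π≈ρ _)

-- Induction: `π` is rebuilt by inserting the image of zero into `remove zero π`. Thus `orbit`,
-- computed from a finite list, takes every permutation into account.
permutations-complete : ∀ n (π : Permutation′ n) → Any (Perm._≈ π) (permutations n)
permutations-complete zero    π = here λ ()
permutations-complete (suc n) π = Any.cartesianProductWith⁺ (insert zero)
  (λ { {y = ρ} refl ρ≈ i → ≡.trans (insert-cong zero (π ⟨$⟩ʳ zero) ρ (remove zero π) ρ≈ i)
                                   (Perm.insert-remove zero π i) })
  (∈-allFin (π ⟨$⟩ʳ zero)) (permutations-complete n (remove zero π))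

-- Orbits

≐-refl : {g : Multidigraph n} → g ≐ g
≐-refl _ _ = refl

≐-sym : {g h : Multidigraph n} → g ≐ h → h ≐ g
≐-sym g≐h i j = ≡.sym (g≐h i j)

≐-trans : {g h k : Multidigraph n} → g ≐ h → h ≐ k → g ≐ k
≐-trans g≐h h≐k i j = ≡.trans (g≐h i j) (h≐k i j)

≐-decSetoid : ℕ → DecSetoid 0ℓ 0ℓ
≐-decSetoid n = record
  { Carrier          = Multidigraph n
  ; _≈_              = _≐_
  ; isDecEquivalence = record
    { isEquivalence = record { refl = ≐-refl ; sym = ≐-sym ; trans = ≐-trans }
    ; _≟_           = _≐?_
    }
  }

fresh⇒∉ : ∀ {g m : Multidigraph n} {hs} → All (λ h → ¬ g ≐ h) hs → g ≐ m → ¬ Any (_≐ m) hs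
fresh⇒∉ g∉hs g≐m = All¬⇒¬Any (All.map (λ g≢h h≐m → g≢h (≐-trans g≐m (≐-sym h≐m))) g∉hs)

-- Moves the action across `_≐_`, which is the form of invertibility that `coefficient-map` asks
-- for.
▷-flip : ∀ (σ : Permutation′ n) {g h} → σ ▷ g ≐ h ⇔ g ≐ flip σ ▷ h
▷-flip σ {g} {h} = mk⇔
  (λ eq i j → ≡.trans (≡.sym (cong₂ g (inverseˡ σ) (inverseˡ σ))) (eq (σ ⟨$⟩ʳ i) (σ ⟨$⟩ʳ j)))
  (λ eq i j → ≡.trans (eq (σ ⟨$⟩ˡ i) (σ ⟨$⟩ˡ j)) (cong₂ h (inverseʳ σ) (inverseʳ σ)))

infix 4 _∈orbit_ _∈orbit?_

_∈orbit_ : Multidigraph n → Multidigraph n → Set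
m ∈orbit g = Any (_≐ m) (orbit g)

_∈orbit?_ : ∀ (m g : Multidigraph n) → Dec (m ∈orbit g)
m ∈orbit? g = any? (_≐? m) (orbit g)

∈orbit⁺ : ∀ σ (g : Multidigraph n) {m} → σ ▷ g ≐ m → m ∈orbit g
∈orbit⁺ {n} σ g eq = Any.deduplicate⁺ _≐?_ (λ y≐x x≐m → ≐-trans y≐x x≐m)
  (Any.map⁺ (Any.map
    (λ {ρ} ρ≈σ → ≐-trans (λ i j → cong₂ g (⟨$⟩ˡ-cong ρ σ ρ≈σ i) (⟨$⟩ˡ-cong ρ σ ρ≈σ j)) eq)
    (permutations-complete n σ)))

∈orbit⁻ : ∀ (g : Multidigraph n) {m} → m ∈orbit g → ∃[ σ ] σ ▷ g ≐ m
∈orbit⁻ {n} g m∈ =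
  Any.satisfied (Any.map⁻ (Any.deduplicate⁻ _≐?_ {xs = map (_▷ g) (permutations n)} m∈))

∈orbit-▷ : ∀ σ (g m : Multidigraph n) → m ∈orbit g ⇔ σ ▷ m ∈orbit g
∈orbit-▷ σ g m = mk⇔ to from
  where
  to : m ∈orbit g → σ ▷ m ∈orbit g
  -- `_∘ₚ_` composes from left to right, so `τ ∘ₚ σ` acts by `τ` first and then by `σ`.
  to m∈ with τ , eq ← ∈orbit⁻ g m∈ = ∈orbit⁺ (τ ∘ₚ σ) g λ i j → eq (σ ⟨$⟩ˡ i) (σ ⟨$⟩ˡ j)

  from : σ ▷ m ∈orbit g → m ∈orbit g
  from σm∈ with τ , eq ← ∈orbit⁻ g σm∈ = ∈orbit⁺ (τ ∘ₚ flip σ) g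
    (≐-sym {g = m} (Equivalence.to (▷-flip σ) (≐-sym {g = τ ▷ g} eq)))

∈orbit-simple : ∀ (g : Multidigraph n) {m} → IsSimple g → m ∈orbit g → IsSimple m
∈orbit-simple g simple m∈ i j with σ , eq ← ∈orbit⁻ g m∈ rewrite ≡.sym (eq i j) =
  simple (σ ⟨$⟩ˡ i) (σ ⟨$⟩ˡ j)

-- Division and reversal of monomials

infix 4 _≼_ _≼?_

_≼_ : Multidigraph n → Multidigraph n → Set
g ≼ m = ∀ i j → g i j ≤ m i j

_≼?_ : ∀ (g m : Multidigraph n) → Dec (g ≼ m)
g ≼? m = all? λ i → all? λ j → g i j ℕ.≤? m i j

infixl 6 _⊖_

_⊖_ : Multidigraph n → Multidigraph n → Multidigraph n
(m ⊖ g) i j = m i j ∸ g i j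

⊕-⊖ : ∀ {g m h : Multidigraph n} → g ≼ m → g ⊕ h ≐ m ⇔ h ≐ m ⊖ g
⊕-⊖ {g = g} {m} {h} g≼m = mk⇔
  (λ eq i j → ≡.trans (≡.sym (ℕ.m+n∸m≡n (g i j) (h i j))) (cong (_∸ g i j) (eq i j)))
  (λ eq i j → ≡.trans (cong (g i j ℕ.+_) (eq i j)) (ℕ.m+[n∸m]≡n (g≼m i j)))

≼-⊕ : ∀ {g m h : Multidigraph n} → g ⊕ h ≐ m → g ≼ m
≼-⊕ {g = g} {h = h} eq i j = ℕ.≤-trans (ℕ.m≤m+n (g i j) (h i j)) (ℕ.≤-reflexive (eq i j))

-- Relabelling the vertices by opposite makes reversal preserve the path
-- 1 → 2 → 3, exchanging its edges.
rev : Multidigraph n → Multidigraph n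
rev g i j = g (opposite j) (opposite i)

rev-adjoint : ∀ {g h : Multidigraph n} → rev g ≐ h ⇔ g ≐ rev h
rev-adjoint {g = g} {h} = mk⇔
  (λ eq i j → ≡.trans (≡.sym (cong₂ g (opposite-involutive i) (opposite-involutive j)))
                      (eq (opposite j) (opposite i)))
  (λ eq i j → ≡.trans (eq (opposite j) (opposite i))
                      (cong₂ h (opposite-involutive i) (opposite-involutive j)))

-- Monomials in x₁₂ and x₂₃

path : ℕ → ℕ → Multidigraph 3
path a b 0F 1F = a
path a b 1F 2F = b
path a b _  _  = 0

-- Truncated subtraction keeps zero exponents at zero, so a quotient of a monomial in x₁₂ and x₂₃ is
-- again one. This is why the restriction of a product depends only on the restrictions of its
-- factors.
path-⊖ : ∀ a b g → path a b ⊖ g ≐ path (a ∸ g 0F 1F) (b ∸ g 1F 2F)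
path-⊖ a b g 0F 0F = ℕ.0∸n≡0 (g 0F 0F)
path-⊖ a b g 0F 1F = refl
path-⊖ a b g 0F 2F = ℕ.0∸n≡0 (g 0F 2F)
path-⊖ a b g 1F 0F = ℕ.0∸n≡0 (g 1F 0F)
path-⊖ a b g 1F 1F = ℕ.0∸n≡0 (g 1F 1F)
path-⊖ a b g 1F 2F = refl
path-⊖ a b g 2F 0F = ℕ.0∸n≡0 (g 2F 0F)
path-⊖ a b g 2F 1F = ℕ.0∸n≡0 (g 2F 1F)
path-⊖ a b g 2F 2F = ℕ.0∸n≡0 (g 2F 2F)

rev-path : ∀ a b → rev (path a b) ≐ path b a
rev-path a b 0F 0F = refl
rev-path a b 0F 1F = refl
rev-path a b 0F 2F = refl
rev-path a b 1F 0F = refl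
rev-path a b 1F 1F = refl
rev-path a b 1F 2F = refl
rev-path a b 2F 0F = refl
rev-path a b 2F 1F = refl
rev-path a b 2F 2F = refl

-- The 3-cycle 0F → 1F → 2F → 0F.
rotation : Permutation′ 3
rotation = transpose 0F 1F ∘ₚ transpose 0F 2F

rotation-path : rotation ▷ path 1 0 ≐ path 0 1
rotation-path = from-yes (rotation ▷ path 1 0 ≐? path 0 1)

path-not-simple₁ : ∀ {a b} → ¬ IsSimple (path (2+ a) b)
path-not-simple₁ simple with simple 0F 1F
... | inj₁ ()
... | inj₂ ()

path-not-simple₂ : ∀ {a b} → ¬ IsSimple (path a (2+ b))
path-not-simple₂ simple with simple 1F 2F
... | inj₁ ()
... | inj₂ ()

module _ {c ℓ₁ ℓ₂} (K : HeytingField c ℓ₁ ℓ₂) where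

  open HeytingField K using (heytingCommutativeRing)
  open CommutativeRing (HeytingCommutativeRing.commutativeRing heytingCommutativeRing)
    hiding (zero)
    renaming (refl to ≈-refl; sym to ≈-sym; trans to ≈-trans; reflexive to ≈-reflexive)
  open CommutativeSemigroupProperties +-commutativeSemigroup using (x∙yz≈y∙xz)
  open SetoidReasoning setoid
  open Polynomials K

  -- Coefficients

  -- The conditional in `coefficient`, named so that its test can be replaced or split on as a plain
  -- Boolean.
  addIf : Bool → Carrier → Carrier → Carrier
  addIf b a r = if b then a + r else r

  addIf-cong : ∀ b {a a′ r r′} → a ≈ a′ → r ≈ r′ → addIf b a r ≈ addIf b a′ r′
  addIf-cong true  a≈a′ r≈r′ = +-cong a≈a′ r≈r′
  addIf-cong false a≈a′ r≈r′ = r≈r′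

  addIf-+ : ∀ b a r s → addIf b a (r + s) ≈ addIf b a r + s
  addIf-+ true  a r s = ≈-sym (+-assoc a r s)
  addIf-+ false a r s = ≈-refl

  addIf-* : ∀ b x a r → addIf b (x * a) (x * r) ≈ x * addIf b a r
  addIf-* true  x a r = ≈-sym (distribˡ x a r)
  addIf-* false x a r = ≈-refl

  coefficient-here : ∀ a {g m : Multidigraph n} p → g ≐ m →
                     coefficient ((a , g) ∷ p) m ≡ a + coefficient p m
  coefficient-here a {g} {m} p g≐m =
    cong (λ b → addIf b a (coefficient p m)) (dec-true (g ≐? m) g≐m)

  coefficient-skip : ∀ a {g m : Multidigraph n} p → ¬ g ≐ m →
                     coefficient ((a , g) ∷ p) m ≡ coefficient p m
  coefficient-skip a {g} {m} p g≢m =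
    cong (λ b → addIf b a (coefficient p m)) (dec-false (g ≐? m) g≢m)

  coefficient-cong : ∀ p {m m′ : Multidigraph n} → m ≐ m′ → coefficient p m ≡ coefficient p m′
  coefficient-cong []            m≐m′ = refl
  coefficient-cong ((a , g) ∷ p) {m} {m′} m≐m′ = cong₂ (λ b → addIf b a)
    (does-⇔ (mk⇔ (λ g≐m → ≐-trans g≐m m≐m′) (λ g≐m′ → ≐-trans g≐m′ (≐-sym m≐m′)))
            (g ≐? m) (g ≐? m′))
    (coefficient-cong p m≐m′)

  coefficient-++ : ∀ p q (m : Multidigraph n) →
                   coefficient (p ++ q) m ≈ coefficient p m + coefficient q m
  coefficient-++ []            q m = ≈-sym (+-identityˡ _)
  coefficient-++ ((a , g) ∷ p) q m =
    ≈-trans (addIf-cong (does (g ≐? m)) ≈-refl (coefficient-++ p q m))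
            (addIf-+ (does (g ≐? m)) a _ _)

  -- The terms counted at `m` after relabelling are exactly those counted at `m′` before it, and in
  -- the same order. Serves for both `_▷_` and `rev`.
  coefficient-map : ∀ (f : Multidigraph n → Multidigraph n) {m m′} →
                    (∀ h → f h ≐ m ⇔ h ≐ m′) →
                    ∀ p → coefficient (map (map₂ f) p) m ≡ coefficient p m′
  coefficient-map f adj []            = refl
  coefficient-map f {m} {m′} adj ((b , h) ∷ p) = cong₂ (λ d → addIf d b)
    (does-⇔ (adj h) (f h ≐? m) (h ≐? m′)) (coefficient-map f adj p)

  -- Products of polynomials

  infixl 7 _⊗_

  _⊗_ : Carrier × Multidigraph n → Carrier × Multidigraph n → Carrier × Multidigraph n
  (a , g) ⊗ (b , h) = a * b , g ⊕ h

  -- Since `g` divides `m`, the truncated difference `m ⊖ g` is the true quotient, and only terms of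
  -- `p` with that exponent reach `m`.
  coefficient-⊗ : ∀ a {g m : Multidigraph n} → g ≼ m → ∀ p →
                  coefficient (map ((a , g) ⊗_) p) m ≈ a * coefficient p (m ⊖ g)
  coefficient-⊗ a g≼m []            = ≈-sym (zeroʳ a)
  coefficient-⊗ a {g} {m} g≼m ((b , h) ∷ p) = begin
    addIf (does (g ⊕ h ≐? m)) (a * b) (coefficient (map ((a , g) ⊗_) p) m)
      ≡⟨ cong (λ d → addIf d (a * b) _) (does-⇔ (⊕-⊖ g≼m) (g ⊕ h ≐? m) (h ≐? m ⊖ g)) ⟩
    addIf (does (h ≐? m ⊖ g)) (a * b) (coefficient (map ((a , g) ⊗_) p) m)
      ≈⟨ addIf-cong (does (h ≐? m ⊖ g)) ≈-refl (coefficient-⊗ a g≼m p) ⟩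
    addIf (does (h ≐? m ⊖ g)) (a * b) (a * coefficient p (m ⊖ g))
      ≈⟨ addIf-* (does (h ≐? m ⊖ g)) a b _ ⟩
    a * coefficient ((b , h) ∷ p) (m ⊖ g) ∎

  coefficient-⊗-⋠ : ∀ a {g m : Multidigraph n} → ¬ g ≼ m → ∀ p →
                    coefficient (map ((a , g) ⊗_) p) m ≡ 0#
  coefficient-⊗-⋠ a g⋠m []            = refl
  coefficient-⊗-⋠ a {g} g⋠m ((b , h) ∷ p) =
    ≡.trans (coefficient-skip (a * b) (map ((a , g) ⊗_) p) (g⋠m ∘ ≼-⊕)) (coefficient-⊗-⋠ a g⋠m p)

  ⊗-comm : ∀ s t (m : Multidigraph n) → coefficient [ s ⊗ t ] m ≈ coefficient [ t ⊗ s ] m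
  ⊗-comm (a , g) (b , h) m = ≈-trans
    (addIf-cong (does (g ⊕ h ≐? m)) (*-comm a b) ≈-refl)
    (≈-reflexive (cong (λ d → addIf d (b * a) 0#)
      (does-⇔ (mk⇔ (≐-trans λ i j → ℕ.+-comm (h i j) (g i j))
                   (≐-trans λ i j → ℕ.+-comm (g i j) (h i j)))
              (g ⊕ h ≐? m) (h ⊕ g ≐? m))))

  -- `_*ₚ_` recurses on its left factor; this is the matching recursion on the right factor, which
  -- lets `*ₚ-comm` go by induction.
  *ₚ-∷ʳ : ∀ (p : Polynomial n) t q m →
          coefficient (p *ₚ (t ∷ q)) m ≈ coefficient (map (t ⊗_) p) m + coefficient (p *ₚ q) m
  *ₚ-∷ʳ []      t q m = ≈-sym (+-identityˡ 0#)
  *ₚ-∷ʳ (s ∷ p) t q m = begin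
    coefficient (s ⊗ t ∷ sq ++ p *ₚ (t ∷ q)) m   ≈⟨ coefficient-++ [ s ⊗ t ] (sq ++ p *ₚ (t ∷ q)) m ⟩
    X + coefficient (sq ++ p *ₚ (t ∷ q)) m       ≈⟨ +-congˡ (coefficient-++ sq (p *ₚ (t ∷ q)) m) ⟩
    X + (S + coefficient (p *ₚ (t ∷ q)) m)       ≈⟨ +-cong (⊗-comm s t m) (+-congˡ (*ₚ-∷ʳ p t q m)) ⟩
    Y + (S + (T + R))                            ≈⟨ +-congˡ (x∙yz≈y∙xz S T R) ⟩
    Y + (T + (S + R))                            ≈⟨ +-assoc Y T (S + R) ⟨
    (Y + T) + (S + R)                            ≈⟨ +-cong (coefficient-++ [ t ⊗ s ] (map (t ⊗_) p) m)
                                                            (coefficient-++ sq (p *ₚ q) m) ⟨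
    coefficient (map (t ⊗_) (s ∷ p)) m + coefficient ((s ∷ p) *ₚ q) m ∎
    where
    sq = map (s ⊗_) q
    X  = coefficient [ s ⊗ t ] m
    Y  = coefficient [ t ⊗ s ] m
    S  = coefficient sq m
    T  = coefficient (map (t ⊗_) p) m
    R  = coefficient (p *ₚ q) m

  *ₚ-comm : ∀ (p q : Polynomial n) → p *ₚ q ≈ₚ q *ₚ p
  *ₚ-comm []      q m =
    ≈-reflexive (cong (λ p → coefficient p m) (≡.sym (cartesianProductWith-zeroʳ _⊗_ q)))
  *ₚ-comm (s ∷ p) q m = begin
    coefficient (map (s ⊗_) q ++ p *ₚ q) m                    ≈⟨ coefficient-++ (map (s ⊗_) q) _ m ⟩
    coefficient (map (s ⊗_) q) m + coefficient (p *ₚ q) m     ≈⟨ +-congˡ (*ₚ-comm p q m) ⟩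
    coefficient (map (s ⊗_) q) m + coefficient (q *ₚ p) m     ≈⟨ *ₚ-∷ʳ q s p m ⟨
    coefficient (q *ₚ (s ∷ p)) m                              ∎

  -- Orbit sums

  coefficient-sum-∉ : ∀ (hs : List (Multidigraph n)) {m} → ¬ Any (_≐ m) hs →
                      coefficient (sum (map x^_ hs)) m ≡ 0#
  coefficient-sum-∉ []       m∉ = refl
  coefficient-sum-∉ (h ∷ hs) m∉ =
    ≡.trans (coefficient-skip 1# (sum (map x^_ hs)) (m∉ ∘ here)) (coefficient-sum-∉ hs (m∉ ∘ there))

  -- Distinctness of the entries ensures that exactly one of them contributes at `m`.
  coefficient-sum-∈ : ∀ {hs : List (Multidigraph n)} {m} → AllPairs (λ g h → ¬ g ≐ h) hs →
                      Any (_≐ m) hs → coefficient (sum (map x^_ hs)) m ≈ 1#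
  coefficient-sum-∈ {hs = h ∷ hs} {m} (h∉hs ∷ unique) (here h≐m) = begin
    coefficient (sum (map x^_ (h ∷ hs))) m   ≡⟨ coefficient-here 1# (sum (map x^_ hs)) h≐m ⟩
    1# + coefficient (sum (map x^_ hs)) m    ≡⟨ cong (1# +_) (coefficient-sum-∉ hs (fresh⇒∉ h∉hs h≐m)) ⟩
    1# + 0#                                  ≈⟨ +-identityʳ 1# ⟩
    1#                                       ∎
  coefficient-sum-∈ {hs = h ∷ hs} (h∉hs ∷ unique) (there m∈hs) = ≈-trans
    (≈-reflexive (coefficient-skip 1# (sum (map x^_ hs)) λ h≐m → fresh⇒∉ h∉hs h≐m m∈hs))
    (coefficient-sum-∈ unique m∈hs)

  coefficient-𝓞-∉ : ∀ (g : Multidigraph n) {m} → ¬ m ∈orbit g → coefficient (𝓞 g) m ≡ 0#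
  coefficient-𝓞-∉ g = coefficient-sum-∉ (orbit g)

  coefficient-𝓞-∈ : ∀ (g : Multidigraph n) {m} → m ∈orbit g → coefficient (𝓞 g) m ≈ 1#
  coefficient-𝓞-∈ {n} g = coefficient-sum-∈
    (Unique.deduplicate-! (≐-decSetoid n) (map (_▷ g) (permutations n)))

  -- `m` and `σ ▷ m` lie in the orbit of `g` together or not at all.
  coefficient-𝓞-▷ : ∀ σ (g m : Multidigraph n) → coefficient (𝓞 g) (σ ▷ m) ≈ coefficient (𝓞 g) m
  coefficient-𝓞-▷ σ g m with m ∈orbit? g
  ... | yes m∈ = ≈-trans (coefficient-𝓞-∈ g (Equivalence.to (∈orbit-▷ σ g m) m∈))
                         (≈-sym (coefficient-𝓞-∈ g m∈))
  ... | no m∉  = ≈-reflexive (≡.trans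
    (coefficient-𝓞-∉ g (m∉ ∘ Equivalence.from (∈orbit-▷ σ g m)))
    (≡.sym (coefficient-𝓞-∉ g m∉)))

  -- Places `𝓞 g₁` in the invariant ring, so that it witnesses the failure of generation.
  𝓞-invariant : ∀ (g : Multidigraph n) → 𝓞 g ∈ 𝓘 n
  𝓞-invariant g σ m = ≈-trans
    (≈-reflexive (coefficient-map (σ ▷_) (λ _ → ▷-flip σ) (𝓞 g)))
    (coefficient-𝓞-▷ (flip σ) g m)

  -- Restriction to x₁₂ and x₂₃

  infix 4 _∼_

  _∼_ : Polynomial 3 → Polynomial 3 → Set ℓ₁
  p ∼ q = ∀ a b → coefficient p (path a b) ≈ coefficient q (path a b)

  *ₚ-congˡ-∼ : ∀ p q q′ → q ∼ q′ → p *ₚ q ∼ p *ₚ q′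
  *ₚ-congˡ-∼ []            q q′ q∼q′ a b = ≈-refl
  *ₚ-congˡ-∼ ((x , g) ∷ p) q q′ q∼q′ a b = begin
    coefficient (map ((x , g) ⊗_) q ++ p *ₚ q) m
      ≈⟨ coefficient-++ (map ((x , g) ⊗_) q) _ m ⟩
    coefficient (map ((x , g) ⊗_) q) m + coefficient (p *ₚ q) m
      ≈⟨ +-cong head (*ₚ-congˡ-∼ p q q′ q∼q′ a b) ⟩
    coefficient (map ((x , g) ⊗_) q′) m + coefficient (p *ₚ q′) m
      ≈⟨ coefficient-++ (map ((x , g) ⊗_) q′) _ m ⟨
    coefficient (map ((x , g) ⊗_) q′ ++ p *ₚ q′) m ∎
    where
    m = path a b

    head : coefficient (map ((x , g) ⊗_) q) m ≈ coefficient (map ((x , g) ⊗_) q′) m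
    -- Either `g` does not divide `m` and nothing contributes, or the quotient is again a `path`,
    -- where `q∼q′` applies.
    head with g ≼? m
    ... | no g⋠m  = ≈-reflexive (≡.trans (coefficient-⊗-⋠ x g⋠m q) (≡.sym (coefficient-⊗-⋠ x g⋠m q′)))
    ... | yes g≼m = begin
      coefficient (map ((x , g) ⊗_) q) m   ≈⟨ coefficient-⊗ x g≼m q ⟩
      x * coefficient q (m ⊖ g)            ≡⟨ cong (x *_) (coefficient-cong q (path-⊖ a b g)) ⟩
      x * coefficient q _                  ≈⟨ *-congˡ (q∼q′ _ _) ⟩
      x * coefficient q′ _                 ≡⟨ cong (x *_) (coefficient-cong q′ (path-⊖ a b g)) ⟨
      x * coefficient q′ (m ⊖ g)           ≈⟨ coefficient-⊗ x g≼m q′ ⟨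
      coefficient (map ((x , g) ⊗_) q′) m  ∎

  -- Commutativity transfers the congruence from the right factor to the left one.
  *ₚ-cong-∼ : ∀ p p′ q q′ → p ∼ p′ → q ∼ q′ → p *ₚ q ∼ p′ *ₚ q′
  *ₚ-cong-∼ p p′ q q′ p∼p′ q∼q′ a b = begin
    coefficient (p *ₚ q) m    ≈⟨ *ₚ-congˡ-∼ p q q′ q∼q′ a b ⟩
    coefficient (p *ₚ q′) m   ≈⟨ *ₚ-comm p q′ m ⟩
    coefficient (q′ *ₚ p) m   ≈⟨ *ₚ-congˡ-∼ q′ p p′ p∼p′ a b ⟩
    coefficient (q′ *ₚ p′) m  ≈⟨ *ₚ-comm q′ p′ m ⟩
    coefficient (p′ *ₚ q′) m  ∎
    where m = path a b

  -- Polynomials with symmetric restriction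

  reverse : Polynomial n → Polynomial n
  reverse = map (map₂ rev)

  -- `rev` only relabels index pairs, so it commutes with `_⊕_` by computation and the two lists
  -- agree term by term.
  reverse-*ₚ : ∀ (p q : Polynomial n) → reverse (p *ₚ q) ≡ reverse p *ₚ reverse q
  reverse-*ₚ []      q = refl
  reverse-*ₚ (s ∷ p) q = ≡.trans (map-++ (map₂ rev) (map (s ⊗_) q) (p *ₚ q))
    (cong₂ _++_ (≡.trans (≡.sym (map-∘ q)) (map-∘ q)) (reverse-*ₚ p q))

  coefficient-reverse : ∀ p a b → coefficient (reverse p) (path a b) ≡ coefficient p (path b a)
  coefficient-reverse p a b =
    ≡.trans (coefficient-map rev (λ _ → rev-adjoint) p) (coefficient-cong p (rev-path a b))

  Symmetric : Polynomial 3 → Set ℓ₁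
  Symmetric p = ∀ a b → coefficient p (path b a) ≈ coefficient p (path a b)

  -- Recasts symmetry as being fixed by `reverse` up to `_∼_`. As `reverse` is multiplicative and
  -- `_∼_` a congruence for products, symmetry then passes to products.
  reverse-∼ : ∀ p → Symmetric p → reverse p ∼ p
  reverse-∼ p sym-p a b = ≈-trans (≈-reflexive (coefficient-reverse p a b)) (sym-p a b)

  symmetric-constant : ∀ x → Symmetric (constant x)
  -- `rev` fixes `empty` by computation, so `reverse (constant x)` is `constant x` itself.
  symmetric-constant x a b = ≈-reflexive (≡.sym (coefficient-reverse (constant x) a b))

  symmetric-+ₚ : ∀ p q → Symmetric p → Symmetric q → Symmetric (p +ₚ q)
  symmetric-+ₚ p q sym-p sym-q a b = begin
    coefficient (p +ₚ q) (path b a)                        ≈⟨ coefficient-++ p q _ ⟩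
    coefficient p (path b a) + coefficient q (path b a)    ≈⟨ +-cong (sym-p a b) (sym-q a b) ⟩
    coefficient p (path a b) + coefficient q (path a b)    ≈⟨ coefficient-++ p q _ ⟨
    coefficient (p +ₚ q) (path a b)                        ∎

  symmetric-*ₚ : ∀ p q → Symmetric p → Symmetric q → Symmetric (p *ₚ q)
  symmetric-*ₚ p q sym-p sym-q a b = begin
    coefficient (p *ₚ q) (path b a)                  ≡⟨ coefficient-reverse (p *ₚ q) a b ⟨
    coefficient (reverse (p *ₚ q)) (path a b)        ≡⟨ cong (λ r → coefficient r (path a b)) (reverse-*ₚ p q) ⟩
    coefficient (reverse p *ₚ reverse q) (path a b)  ≈⟨ *ₚ-cong-∼ (reverse p) p (reverse q) q (reverse-∼ p sym-p) (reverse-∼ q sym-q) a b ⟩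
    coefficient (p *ₚ q) (path a b)                  ∎

  symmetric-𝓞 : ∀ g → IsSimple g → Symmetric (𝓞 g)
  symmetric-𝓞 g simple = symmetric
    where
    vanishes : ∀ m → ¬ IsSimple m → coefficient (𝓞 g) m ≈ 0#
    vanishes m ¬simple = ≈-reflexive (coefficient-𝓞-∉ g (¬simple ∘ ∈orbit-simple g simple))

    rotates : coefficient (𝓞 g) (path 0 1) ≈ coefficient (𝓞 g) (path 1 0)
    rotates = ≈-trans (≈-reflexive (coefficient-cong (𝓞 g) (≐-sym {g = rotation ▷ path 1 0} rotation-path)))
                      (coefficient-𝓞-▷ rotation g (path 1 0))

    symmetric : Symmetric (𝓞 g)
    symmetric 0      0      = ≈-refl
    symmetric 0      1      = ≈-sym rotates
    symmetric 1      0      = rotates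
    symmetric 1      1      = ≈-refl
    -- Once an exponent is at least 2, neither monomial is simple, and both coefficients vanish.
    symmetric (2+ a) b      = ≈-trans (vanishes (path b (2+ a)) path-not-simple₂)
                                      (≈-sym (vanishes (path (2+ a) b) path-not-simple₁))
    symmetric a      (2+ b) = ≈-trans (vanishes (path (2+ b) a) path-not-simple₁)
                                      (≈-sym (vanishes (path a (2+ b)) path-not-simple₂))

  ⟨simple⟩-symmetric : ∀ {p} → p ∈ ⟨ SimpleOrbitSums 3 ⟩ → Symmetric p
  ⟨simple⟩-symmetric (generator (g , simple , p≈𝓞g)) a b =
    ≈-trans (p≈𝓞g _) (≈-trans (symmetric-𝓞 g simple a b) (≈-sym (p≈𝓞g _)))
  ⟨simple⟩-symmetric (scalar x) = symmetric-constant x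
  ⟨simple⟩-symmetric (_⟨+⟩_ {p} {q} p∈ q∈) =
    symmetric-+ₚ p q (⟨simple⟩-symmetric p∈) (⟨simple⟩-symmetric q∈)
  ⟨simple⟩-symmetric (_⟨*⟩_ {p} {q} p∈ q∈) =
    symmetric-*ₚ p q (⟨simple⟩-symmetric p∈) (⟨simple⟩-symmetric q∈)
  ⟨simple⟩-symmetric (respects p≈q p∈) a b =
    ≈-trans (≈-sym (p≈q _)) (≈-trans (⟨simple⟩-symmetric p∈ a b) (p≈q _))

mainTheorem10 : ∀ {c ℓ₁ ℓ₂} (K : HeytingField c ℓ₁ ℓ₂) → CharacteristicZero K →
    let open Polynomials K in
    𝓞 g₁ ∉ ⟨ SimpleOrbitSums 3 ⟩ ×
    𝓞 g₂ ∉ ⟨ SimpleOrbitSums 3 ⟩ ×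
    ¬ (𝓘 3 ⊆ ⟨ SimpleOrbitSums 3 ⟩)
mainTheorem10 K char0 =
    𝓞g₁∉
  -- `g₂` has the exponents of `path 1 2`, and `path 2 1` is not in its orbit. Symmetry at 2, 1
  -- therefore computes to `1# + 0# ≈ 0#`, which is what `char0 0` refutes.
  , (λ 𝓞g₂∈ → char0 0 (⟨simple⟩-symmetric K 𝓞g₂∈ 2 1))
  , λ 𝓘⊆ → 𝓞g₁∉ (𝓘⊆ (𝓞-invariant K g₁))
  where
  open Polynomials K

  𝓞g₁∉ : 𝓞 g₁ ∉ ⟨ SimpleOrbitSums 3 ⟩
  -- Here `g₁` has the exponents of `path 2 1`, so symmetry is taken at 1, 2 to have the nonzero
  -- coefficient on the left.
  𝓞g₁∉ 𝓞g₁∈ = char0 0 (⟨simple⟩-symmetric K 𝓞g₁∈ 1 2)
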